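{- Every finite connected simple graph is (isomorphic to) an induced subgraph of an SR-graph.
   Context: $\gamma(G)$ denotes the domination number of a finite simple graph $G$. For an edge $e=uv$ of $G$, $G-e$ is the graph obtained by deleting $e$, and $G_e$ is the graph obtained by subdividing $e$: delete $e$, add a new vertex $w$ and the edges $uw$ and $wv$. A finite connected simple graph $G$ of order at least two is an SR-graph (sub-removable graph) if $\gamma(G-e)=\gamma(G_e)$ for every edge $e$ of $G$. -}

module Defs where

open import Data.Empty using (⊥)
open import Data.Fin using (Fin; zero; suc)
open import Data.Fin.Properties using (_≟_; any?; all?)
open import Data.Fin.Subset using (Subset; _∈_; ⊤; ∣_∣)
open import Data.Fin.Subset.Properties using (_∈?_; ∈⊤; anySubset?)
open import Data.Nat using (ℕ; suc; _≤_; _<_; _<?_)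
open import Data.Nat.Induction using (<-wellFounded)
open import Data.Nat.Properties using (≮⇒≥)
open import Data.Product using (Σ; ∃; _×_; _,_; proj₁; proj₂; swap)
import Data.Product as Product
open import Data.Sum using (_⊎_; inj₁; inj₂)
import Data.Sum as Sum
open import Function using (_∘_; _⇔_; _↔_; Inverse)
open import Induction.WellFounded using (Acc; acc)
open import Level using (0ℓ)
open import Relation.Binary.Construct.Closure.ReflexiveTransitive using (Star)
open import Relation.Binary.Core using (Rel)
open import Relation.Binary.Definitions using (Symmetric; Irreflexive; Decidable)
open import Relation.Binary.PropositionalEquality using (_≡_; refl)
open import Relation.Nullary using (¬_; Dec; yes; no; ¬?; _×-dec_; _⊎-dec_)
import Relation.Unary as Unary

record Graph (V : Set) : Set₁ where
  field
    Adj    : Rel V 0ℓ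
    sym    : Symmetric Adj
    irrefl : Irreflexive _≡_ Adj
    adj?   : Decidable Adj

open Graph

-- The graph with no vertices does not count as connected.
Connected : ∀ {n} → Graph (Fin n) → Set
Connected {n} G = 1 ≤ n × (∀ u v → Star (Adj G) u v)

Dominating : ∀ {n} → Graph (Fin n) → Subset n → Set
Dominating G S = ∀ v → v ∈ S ⊎ ∃ λ u → u ∈ S × Adj G u v

dominating? : ∀ {n} (G : Graph (Fin n)) → Unary.Decidable (Dominating G)
dominating? G S =
  all? λ v → (v ∈? S) ⊎-dec any? λ u → (u ∈? S) ×-dec adj? G u v

MinimumDominating : ∀ {n} → Graph (Fin n) → Subset n → Set
MinimumDominating G S =
  Dominating G S × (∀ T → Dominating G T → ∣ S ∣ ≤ ∣ T ∣)

minimumDominatingSet : ∀ {n} (G : Graph (Fin n)) → ∃ (MinimumDominating G)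
minimumDominatingSet {n} G = descend ⊤ (λ _ → inj₁ ∈⊤) (<-wellFounded _)
  where
  descend : ∀ S → Dominating G S → Acc _<_ ∣ S ∣ → ∃ (MinimumDominating G)
  descend S dom (acc rs)
    with anySubset? (λ T → dominating? G T ×-dec (∣ T ∣ <? ∣ S ∣))
  ... | yes (T , domT , T<S) = descend T domT (rs T<S)
  ... | no  none = S , dom , λ T domT → ≮⇒≥ λ T<S → none (T , domT , T<S)

γ : ∀ {n} → Graph (Fin n) → ℕ
γ G = ∣ proj₁ (minimumDominatingSet G) ∣

-- The unordered pairs {a , b} and {u , v} coincide.
SamePair : ∀ {n} (u v a b : Fin n) → Set
SamePair u v a b = (a ≡ u × b ≡ v) ⊎ (a ≡ v × b ≡ u)

samePair? : ∀ {n} (u v a b : Fin n) → Dec (SamePair u v a b)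
samePair? u v a b =
  ((a ≟ u) ×-dec (b ≟ v)) ⊎-dec ((a ≟ v) ×-dec (b ≟ u))

samePair-sym : ∀ {n} (u v : Fin n) → Symmetric (SamePair u v)
samePair-sym u v = Sum.swap ∘ Sum.map swap swap

deleteEdge : ∀ {n} → Graph (Fin n) → Fin n → Fin n → Graph (Fin n)
deleteEdge G u v = record
  { Adj    = λ a b → Adj G a b × ¬ SamePair u v a b
  ; sym    = Product.map (sym G) (_∘ samePair-sym u v)
  ; irrefl = λ a≡b → irrefl G a≡b ∘ proj₁
  ; adj?   = λ a b → adj? G a b ×-dec ¬? (samePair? u v a b)
  }

-- The new vertex is zero; an old vertex a becomes suc a.
subdivideEdge : ∀ {n} → Graph (Fin n) → Fin n → Fin n → Graph (Fin (suc n))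
subdivideEdge {n} G u v = record
  { Adj = E ; sym = λ {a} {b} → E-sym a b ; irrefl = E-irrefl ; adj? = E? }
  where
  G-e : Graph (Fin n)
  G-e = deleteEdge G u v

  E : Rel (Fin (suc n)) 0ℓ
  E zero    zero    = ⊥
  E zero    (suc b) = b ≡ u ⊎ b ≡ v
  E (suc a) zero    = a ≡ u ⊎ a ≡ v
  E (suc a) (suc b) = Adj G-e a b

  E-sym : ∀ a b → E a b → E b a
  E-sym zero    (suc b) e = e
  E-sym (suc a) zero    e = e
  E-sym (suc a) (suc b) e = sym G-e e

  E-irrefl : Irreflexive _≡_ E
  E-irrefl {suc a} refl e = irrefl G-e refl e

  E? : Decidable E
  E? zero    zero    = no λ ()
  E? zero    (suc b) = (b ≟ u) ⊎-dec (b ≟ v)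
  E? (suc a) zero    = (a ≟ u) ⊎-dec (a ≟ v)
  E? (suc a) (suc b) = adj? G-e a b

record IsSRGraph {n} (G : Graph (Fin n)) : Set where
  field
    order≥2   : 2 ≤ n
    connected : Connected G
    removable : ∀ u v → Adj G u v →
                γ (deleteEdge G u v) ≡ γ (subdivideEdge G u v)

induced : ∀ {n} → Graph (Fin n) → (S : Subset n) → Graph (∃ (_∈ S))
induced G S = record
  { Adj    = λ a b → Adj G (proj₁ a) (proj₁ b)
  ; sym    = sym G
  ; irrefl = λ { refl → irrefl G refl }
  ; adj?   = λ a b → adj? G (proj₁ a) (proj₁ b)
  }

infix 4 _≅_

_≅_ : {V W : Set} → Graph V → Graph W → Set
_≅_ {V} {W} G H = Σ (V ↔ W) λ f →
  ∀ a b → Adj G a b ⇔ Adj H (Inverse.to f a) (Inverse.to f b)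

{-# OPTIONS --safe #-}

-- Attach two leaves to every vertex of G. Every vertex of G has a leaf as a
-- private obligation, so the domination number is |G|, attained by V(G).
-- Deleting or subdividing an edge of G changes nothing. Deleting or
-- subdividing the edge to a leaf l raises the number to |G| + 1: the other
-- leaf at that vertex is still there, and dominating l costs one more vertex.

module Submission where

open import Defs
open import Data.Empty using (⊥; ⊥-elim)
open import Data.Fin using (Fin; zero; suc; combine; remQuot; quotient; punchIn)
open import Data.Fin.Properties using
  ( _≟_; 0≢1+n; suc-injective; punchInᵢ≢i; remQuot-combine
  ; combine-injectiveˡ; combine-injectiveʳ; combine-surjective )
open import Data.Fin.Subset using (Subset; inside; outside; _∈_; ⁅_⁆; _∪_; ∣_∣; _-_)
  renaming (⊥ to ∅)
open import Data.Fin.Subset.Properties using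
  ( ∉⊥; ∣⊥∣≡0; ∣⁅x⁆∣≡1; x∈⁅x⁆; x∈⁅y⁆⇒x≡y; x∈p∪q⁺; x∈p∪q⁻
  ; x∈p∧x≢y⇒x∈p-y; x∈p⇒∣p-x∣<∣p∣ )
open import Data.Nat using (ℕ; zero; suc; _+_; _*_; _≤_; z≤n; s≤s)
open import Data.Nat.Properties using
  ( ≤-trans; ≤-reflexive; ≤-antisym; m≤n⇒m≤1+n; +-suc; +-mono-≤; *-monoˡ-≤ )
open import Data.Product using (∃; ∃₂; _×_; _,_; proj₁; proj₂)
import Data.Product as Product
open import Data.Sum using (_⊎_; inj₁; inj₂; [_,_]′)
import Data.Sum as Sum
open import Data.Vec.Base using ([]; _∷_; here; there)
open import Function using (id; _∘_; _⇔_; _↔_; mk⇔; mk↔ₛ′)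
open import Function.Definitions using (Injective)
open import Level using (0ℓ)
open import Relation.Binary.Construct.Closure.ReflexiveTransitive
  using (Star; ε; _◅_; _◅◅_; gmap)
open import Relation.Binary.Core using (Rel)
open import Relation.Binary.Definitions using (Symmetric; Irreflexive; Decidable)
open import Relation.Binary.PropositionalEquality
  using (_≡_; _≢_; refl; sym; trans; cong; subst₂)
open import Relation.Nullary using (yes; no; contradiction)

private
  variable
    k n : ℕ

-- Images of finite maps, their cardinality, and induced subgraphs.

∈-irrelevant : {p : Subset n} {x : Fin n} (x∈ x∈′ : x ∈ p) → x∈ ≡ x∈′
∈-irrelevant here       here        = refl
∈-irrelevant (there x∈) (there x∈′) = cong there (∈-irrelevant x∈ x∈′)

∣p∪q∣≤∣p∣+∣q∣ : (p q : Subset n) → ∣ p ∪ q ∣ ≤ ∣ p ∣ + ∣ q ∣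
∣p∪q∣≤∣p∣+∣q∣ []            []            = z≤n
∣p∪q∣≤∣p∣+∣q∣ (outside ∷ p) (outside ∷ q) = ∣p∪q∣≤∣p∣+∣q∣ p q
∣p∪q∣≤∣p∣+∣q∣ (outside ∷ p) (inside  ∷ q) =
  ≤-trans (s≤s (∣p∪q∣≤∣p∣+∣q∣ p q)) (≤-reflexive (sym (+-suc ∣ p ∣ ∣ q ∣)))
∣p∪q∣≤∣p∣+∣q∣ (inside  ∷ p) (outside ∷ q) = s≤s (∣p∪q∣≤∣p∣+∣q∣ p q)
∣p∪q∣≤∣p∣+∣q∣ (inside  ∷ p) (inside  ∷ q) =
  s≤s (≤-trans (m≤n⇒m≤1+n (∣p∪q∣≤∣p∣+∣q∣ p q)) (≤-reflexive (sym (+-suc ∣ p ∣ ∣ q ∣))))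

image : (Fin k → Fin n) → Subset n
image {zero}  f = ∅
image {suc k} f = ⁅ f zero ⁆ ∪ image (f ∘ suc)

∈-image⁺ : (f : Fin k → Fin n) (i : Fin k) → f i ∈ image f
∈-image⁺ f zero    = x∈p∪q⁺ (inj₁ (x∈⁅x⁆ (f zero)))
∈-image⁺ f (suc i) = x∈p∪q⁺ {p = ⁅ f zero ⁆} (inj₂ (∈-image⁺ (f ∘ suc) i))

∈-image⁻ : (f : Fin k → Fin n) {x : Fin n} → x ∈ image f → ∃ λ i → f i ≡ x
∈-image⁻ {zero}  f x∈ = contradiction x∈ ∉⊥
∈-image⁻ {suc k} f x∈ =
  [ (λ x∈⁅⁆ → zero , sym (x∈⁅y⁆⇒x≡y _ x∈⁅⁆))
  , Product.map suc id ∘ ∈-image⁻ (f ∘ suc)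
  ]′ (x∈p∪q⁻ ⁅ f zero ⁆ (image (f ∘ suc)) x∈)

∣image∣≤ : (f : Fin k → Fin n) → ∣ image f ∣ ≤ k
∣image∣≤ {zero}  {n} f = ≤-reflexive (∣⊥∣≡0 n)
∣image∣≤ {suc k} f = ≤-trans (∣p∪q∣≤∣p∣+∣q∣ ⁅ f zero ⁆ (image (f ∘ suc)))
  (+-mono-≤ (≤-reflexive (∣⁅x⁆∣≡1 (f zero))) (∣image∣≤ (f ∘ suc)))

-- Induction on `k`: removing `f zero` lowers the size of `S`, and injectivity keeps the remaining
-- values in `S - f zero`.
injective⇒≤∣∣ : (f : Fin k → Fin n) → Injective _≡_ _≡_ f →
                (S : Subset n) → (∀ i → f i ∈ S) → k ≤ ∣ S ∣
injective⇒≤∣∣ {zero}  f inj S f∈ = z≤n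
injective⇒≤∣∣ {suc k} f inj S f∈ = ≤-trans
  (s≤s (injective⇒≤∣∣ (f ∘ suc) (suc-injective ∘ inj) (S - f zero)
    λ i → x∈p∧x≢y⇒x∈p-y (f∈ (suc i)) (0≢1+n ∘ sym ∘ inj)))
  (x∈p⇒∣p-x∣<∣p∣ (f∈ zero))

≅-induced-image : {G : Graph (Fin k)} {H : Graph (Fin n)} (f : Fin k → Fin n) →
                  Injective _≡_ _≡_ f →
                  (∀ a b → Graph.Adj G a b ⇔ Graph.Adj H (f a) (f b)) →
                  G ≅ induced H (image f)
≅-induced-image {k} f inj adj = bijection , adj
  where
  bijection : Fin k ↔ ∃ (_∈ image f)
  bijection = mk↔ₛ′ (λ i → f i , ∈-image⁺ f i) (λ (_ , x∈) → proj₁ (∈-image⁻ f x∈))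
    (λ (_ , x∈) → ≡-∈ (proj₂ (∈-image⁻ f x∈)))
    (λ i → inj (proj₂ (∈-image⁻ f (∈-image⁺ f i))))
    where
    ≡-∈ : ∀ {x y} {x∈ : x ∈ image f} {y∈ : y ∈ image f} →
          x ≡ y → _≡_ {A = ∃ (_∈ image f)} (x , x∈) (y , y∈)
    -- Membership proofs are unique, so elements of the subtype agree as soon as their vertices do.
    ≡-∈ {x} refl = cong (x ,_) (∈-irrelevant _ _)

-- Bounds on the domination number by dominating families and packings.

Dominates : Graph (Fin n) → Rel (Fin n) 0ℓ
Dominates G x y = x ≡ y ⊎ Graph.Adj G x y

-- A minimum dominating set is no larger than `image f`. Repeated values of `f` only make the image
-- smaller.
γ≤ : (G : Graph (Fin n)) (f : Fin k → Fin n) →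
     (∀ x → ∃ λ i → Dominates G (f i) x) → γ G ≤ k
γ≤ G f dom =
  ≤-trans (proj₂ (proj₂ (minimumDominatingSet G)) (image f) dominating) (∣image∣≤ f)
  where
  dominating : Dominating G (image f)
  dominating x with dom x
  ... | i , inj₁ refl = inj₁ (∈-image⁺ f i)
  ... | i , inj₂ e    = inj₂ (f i , ∈-image⁺ f i , e)

-- The hypothesis says that the closed neighbourhoods of the g i are pairwise
-- disjoint: c tells which of them a vertex belongs to.
≤γ : (G : Graph (Fin n)) (g : Fin k → Fin n) (c : Fin n → Fin k) →
     (∀ i x → Dominates G x (g i) → c x ≡ i) → k ≤ γ G
≤γ {n} {k} G g c packed =
  injective⇒≤∣∣ (proj₁ ∘ dominator) injective S (proj₁ ∘ proj₂ ∘ dominator)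
  where
  S : Subset n
  S = proj₁ (minimumDominatingSet G)

  dominator : ∀ i → ∃ λ x → x ∈ S × Dominates G x (g i)
  dominator i with proj₁ (proj₂ (minimumDominatingSet G)) (g i)
  ... | inj₁ g∈           = g i , g∈ , inj₁ refl
  ... | inj₂ (x , x∈ , e) = x , x∈ , inj₂ e

  -- The colour of a dominator recovers the index of its target, so distinct targets have distinct
  -- dominators in `S`.
  colour-dominator : ∀ i → c (proj₁ (dominator i)) ≡ i
  colour-dominator i = packed i _ (proj₂ (proj₂ (dominator i)))

  injective : Injective _≡_ _≡_ (proj₁ ∘ dominator)
  injective {i} {j} eq =
    trans (sym (colour-dominator i)) (trans (cong c eq) (colour-dominator j))

-- A dominating family and a packing of equal size k in G - uv, which remain so
-- in the subdivision: the new vertex is dominated by centre touching, and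
-- dominates target i only for i ≡ free.
record Certificate (G : Graph (Fin n)) (u v : Fin n) : Set where
  field
    {size}     : ℕ
    centre     : Fin size → Fin n
    target     : Fin size → Fin n
    colour     : Fin n → Fin size
    dominates  : ∀ x → ∃ λ i → Dominates (deleteEdge G u v) (centre i) x
    packed     : ∀ i x → Dominates (deleteEdge G u v) x (target i) → colour x ≡ i
    touching   : Fin size
    touches    : centre touching ≡ u ⊎ centre touching ≡ v
    free       : Fin size
    target-end : ∀ i → target i ≡ u ⊎ target i ≡ v → free ≡ i

-- The edge is unordered but `Certificate` lists its ends in order; with this, leaf edges are
-- treated with the hub first only.
certificate-swap : {G : Graph (Fin n)} {u v : Fin n} →
                   Certificate G u v → Certificate G v u
certificate-swap C = record
  { centre     = centre
  ; target     = target
  ; colour     = colour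
  ; dominates  = Product.map₂ (Sum.map₂ (Product.map₂ (_∘ Sum.swap))) ∘ dominates
  ; packed     = λ i x → packed i x ∘ Sum.map₂ (Product.map₂ (_∘ Sum.swap))
  ; touching   = touching
  ; touches    = Sum.swap touches
  ; free       = free
  ; target-end = λ i → target-end i ∘ Sum.swap
  }
  where open Certificate C

-- Both numbers equal `size`: in each graph the centres bound `γ` from above and the targets from
-- below.
certificate⇒γ≡ : {G : Graph (Fin n)} {u v : Fin n} → Certificate G u v →
                 γ (deleteEdge G u v) ≡ γ (subdivideEdge G u v)
certificate⇒γ≡ {n} {G} {u} {v} C = trans
  (≤-antisym (γ≤ G-e centre dominates) (≤γ G-e target colour packed))
  (sym (≤-antisym (γ≤ Gₑ (suc ∘ centre) dominates′)
                  (≤γ Gₑ (suc ∘ target) colour′ packed′)))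
  where
  open Certificate C

  G-e : Graph (Fin n)
  G-e = deleteEdge G u v

  Gₑ : Graph (Fin (suc n))
  Gₑ = subdivideEdge G u v

  dominates′ : ∀ x → ∃ λ i → Dominates Gₑ (suc (centre i)) x
  dominates′ zero    = touching , inj₂ touches
  -- Between old vertices, adjacency in `Gₑ` is by definition that of `G-e`.
  dominates′ (suc x) = Product.map₂ (Sum.map₁ (cong suc)) (dominates x)

  colour′ : Fin (suc n) → Fin size
  colour′ zero    = free
  colour′ (suc x) = colour x

  packed′ : ∀ i x → Dominates Gₑ x (suc (target i)) → colour′ x ≡ i
  packed′ i zero    (inj₂ e) = target-end i e
  packed′ i (suc x) d        = packed i x (Sum.map₁ suc-injective d)

-- The corona with two leaves at every vertex.

module TwoLeafCorona {n : ℕ} (G : Graph (Fin n)) where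

  -- Each vertex of `G` owns a block of three: index `zero` is the vertex itself, the indices
  -- `suc j` are its leaves.
  hub : Fin n → Fin (n * 3)
  hub a = combine a zero

  leaf : Fin n → Fin 2 → Fin (n * 3)
  leaf a j = combine a (suc j)

  Adj′ : Rel (Fin n × Fin 3) 0ℓ
  Adj′ (a , zero)  (b , zero)  = Graph.Adj G a b
  Adj′ (a , zero)  (b , suc _) = a ≡ b
  Adj′ (a , suc _) (b , zero)  = a ≡ b
  Adj′ (a , suc _) (b , suc _) = ⊥

  Adj′-sym : Symmetric Adj′
  Adj′-sym {_ , zero}  {_ , zero}  e = Graph.sym G e
  Adj′-sym {_ , zero}  {_ , suc _} e = sym e
  Adj′-sym {_ , suc _} {_ , zero}  e = sym e

  Adj′-irrefl : Irreflexive _≡_ Adj′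
  Adj′-irrefl {_ , zero} refl e = Graph.irrefl G refl e

  Adj′? : Decidable Adj′
  Adj′? (a , zero)  (b , zero)  = Graph.adj? G a b
  Adj′? (a , zero)  (b , suc _) = a ≟ b
  Adj′? (a , suc _) (b , zero)  = a ≟ b
  Adj′? (a , suc _) (b , suc _) = no λ ()

  corona : Graph (Fin (n * 3))
  corona = record
    { Adj    = λ x y → Adj′ (remQuot 3 x) (remQuot 3 y)
    ; sym    = λ {x} {y} → Adj′-sym {remQuot 3 x} {remQuot 3 y}
    ; irrefl = λ x≡y → Adj′-irrefl (cong (remQuot 3) x≡y)
    ; adj?   = λ x y → Adj′? (remQuot 3 x) (remQuot 3 y)
    }

  open Graph corona using (Adj)

  -- `remQuot 3 (combine a i)` does not reduce to `(a , i)`, so adjacency is transported along the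
  -- equation.
  adj⁺ : ∀ a i b j → Adj′ (a , i) (b , j) → Adj (combine a i) (combine b j)
  adj⁺ a i b j = subst₂ Adj′ (sym (remQuot-combine a i)) (sym (remQuot-combine b j))

  adj⁻ : ∀ a i b j → Adj (combine a i) (combine b j) → Adj′ (a , i) (b , j)
  adj⁻ a i b j = subst₂ Adj′ (remQuot-combine a i) (remQuot-combine b j)

  hub-leaf : ∀ a j → Adj (hub a) (leaf a j)
  hub-leaf a j = adj⁺ a zero a (suc j) refl

  -- This makes leaves good packing targets: the closed neighbourhood of a leaf stays within its
  -- block.
  leaf-neighbour : ∀ {x} a j → Adj x (leaf a j) → x ≡ hub a
  leaf-neighbour {x} a j e with combine-surjective {n} {3} x
  ... | b , zero  , refl = cong hub (adj⁻ b zero a (suc j) e)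
  ... | b , suc i , refl = ⊥-elim (adj⁻ b (suc i) a (suc j) e)

  hub≢leaf : ∀ {a b j} → hub a ≢ leaf b j
  hub≢leaf {a} {b} {j} eq = 0≢1+n (combine-injectiveʳ a zero b (suc j) eq)

  quotient-combine : ∀ (a : Fin n) (i : Fin 3) → quotient 3 (combine a i) ≡ a
  quotient-combine a i = cong proj₁ (remQuot-combine a i)

  -- The hubs dominate and one leaf from each block forms the packing, coloured by block.
  hubEdge : ∀ a b → Certificate corona (hub a) (hub b)
  hubEdge a b = record
    { centre     = hub
    ; target     = λ d → leaf d zero
    ; colour     = quotient 3
    ; dominates  = dominates
    ; packed     = packed
    ; touching   = a
    ; touches    = inj₁ refl
    -- Any index would do: the targets are leaves, while both ends of the edge are hubs.
    ; free       = a
    ; target-end = λ i → ⊥-elim ∘ [ hub≢leaf ∘ sym , hub≢leaf ∘ sym ]′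
    }
    where
    H-e : Graph (Fin (n * 3))
    H-e = deleteEdge corona (hub a) (hub b)

    dominates : ∀ x → ∃ λ d → Dominates H-e (hub d) x
    dominates x with combine-surjective {n} {3} x
    ... | d , zero  , refl = d , inj₁ refl
    ... | d , suc i , refl = d , inj₂
      (hub-leaf d i , [ hub≢leaf ∘ sym ∘ proj₂ , hub≢leaf ∘ sym ∘ proj₂ ]′)

    packed : ∀ d x → Dominates H-e x (leaf d zero) → quotient 3 x ≡ d
    packed d x (inj₁ refl) = quotient-combine d (suc zero)
    packed d x (inj₂ (e , _)) with refl ← leaf-neighbour d zero e =
      quotient-combine d zero

  -- Deletion isolates the leaf, which becomes an additional centre and target at index `zero`. As a
  -- centre it also dominates the subdividing vertex.
  leafEdge : ∀ a j → Certificate corona (hub a) (leaf a j)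
  leafEdge a j = record
    { centre     = centre
    ; target     = target
    ; colour     = colour
    ; dominates  = dominates
    ; packed     = packed
    ; touching   = zero
    ; touches    = inj₂ refl
    ; free       = zero
    ; target-end = target-end
    }
    where
    H-e : Graph (Fin (n * 3))
    H-e = deleteEdge corona (hub a) (leaf a j)

    otherLeaf : Fin n → Fin (n * 3)
    -- `punchIn j zero` is the element of `Fin 2` other than `j`. Using it in every block avoids
    -- singling out `a`.
    otherLeaf d = leaf d (punchIn j zero)

    otherLeaf≢leaf : ∀ {d} → otherLeaf d ≢ leaf a j
    otherLeaf≢leaf {d} =
      punchInᵢ≢i j zero ∘ suc-injective ∘ combine-injectiveʳ d _ a (suc j)

    centre target : Fin (suc n) → Fin (n * 3)
    centre zero    = leaf a j
    centre (suc d) = hub d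
    target zero    = leaf a j
    target (suc d) = otherLeaf d

    -- The isolated leaf shares its block with `otherLeaf a`, so the block alone cannot separate
    -- these two targets.
    colour : Fin (n * 3) → Fin (suc n)
    colour x with x ≟ leaf a j
    ... | yes _ = zero
    ... | no  _ = suc (quotient 3 x)

    colour-leaf : colour (leaf a j) ≡ zero
    colour-leaf with leaf a j ≟ leaf a j
    ... | yes _ = refl
    ... | no ≢  = contradiction refl ≢

    colour-combine : ∀ d i → combine d i ≢ leaf a j → colour (combine d i) ≡ suc d
    colour-combine d i ≢ with combine d i ≟ leaf a j
    ... | yes eq = contradiction eq ≢
    ... | no  _  = cong suc (quotient-combine d i)

    dominates : ∀ x → ∃ λ i → Dominates H-e (centre i) x
    dominates x with combine-surjective {n} {3} x
    ... | d , zero  , refl = suc d , inj₁ refl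
    ... | d , suc i , refl with leaf a j ≟ leaf d i
    ...   | yes eq = zero , inj₁ eq
    ...   | no  ≢  = suc d , inj₂
      (hub-leaf d i , [ ≢ ∘ sym ∘ proj₂ , hub≢leaf ∘ proj₁ ]′)

    packed : ∀ i x → Dominates H-e x (target i) → colour x ≡ i
    packed zero    x (inj₁ refl) = colour-leaf
    -- The only edge of the corona at this leaf is the deleted one.
    packed zero    x (inj₂ (e , kept)) =
      contradiction (inj₁ (leaf-neighbour a j e , refl)) kept
    packed (suc d) x (inj₁ refl) = colour-combine d _ otherLeaf≢leaf
    packed (suc d) x (inj₂ (e , _)) with refl ← leaf-neighbour d _ e =
      colour-combine d zero hub≢leaf

    target-end : ∀ i → target i ≡ hub a ⊎ target i ≡ leaf a j → zero ≡ i
    target-end zero    _ = refl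
    target-end (suc d) = ⊥-elim ∘ [ hub≢leaf ∘ sym , otherLeaf≢leaf ]′

  certificate : ∀ u v → Adj u v → Certificate corona u v
  certificate u v e with combine-surjective {n} {3} u | combine-surjective {n} {3} v
  ... | a , zero  , refl | b , zero  , refl = hubEdge a b
  -- A hub and a leaf are adjacent only within one block, so `e` identifies `b` with `a`.
  ... | a , zero  , refl | b , suc j , refl
    with refl ← adj⁻ a zero b (suc j) e = leafEdge a j
  ... | a , suc i , refl | b , zero  , refl
    with refl ← adj⁻ a (suc i) b zero e = certificate-swap (leafEdge a i)
  ... | a , suc i , refl | b , suc j , refl = ⊥-elim (adj⁻ a (suc i) b (suc j) e)

  -- Connectedness of the corona, and the embedding of `G` as its hubs.

  module _ (connected : Connected G) where

    hub-path : ∀ a b → Star Adj (hub a) (hub b)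
    hub-path a b = gmap hub (adj⁺ _ zero _ zero) (proj₂ connected a b)

    path : ∀ u v → Star Adj u v
    path u v with combine-surjective {n} {3} u | combine-surjective {n} {3} v
    ... | a , zero  , refl | b , zero  , refl = hub-path a b
    ... | a , zero  , refl | b , suc j , refl = hub-path a b ◅◅ hub-leaf b j ◅ ε
    ... | a , suc i , refl | b , zero  , refl =
      adj⁺ a (suc i) a zero refl ◅ hub-path a b
    ... | a , suc i , refl | b , suc j , refl =
      adj⁺ a (suc i) a zero refl ◅ hub-path a b ◅◅ hub-leaf b j ◅ ε

    -- `Connected` includes `1 ≤ n`, and even a single vertex yields a corona of order three.
    3≤n*3 : 3 ≤ n * 3
    3≤n*3 = *-monoˡ-≤ 3 (proj₁ connected)

    corona-isSRGraph : IsSRGraph corona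
    corona-isSRGraph = record
      { order≥2   = ≤-trans (s≤s (s≤s z≤n)) 3≤n*3
      ; connected = ≤-trans (s≤s z≤n) 3≤n*3 , path
      ; removable = λ u v e → certificate⇒γ≡ (certificate u v e)
      }

  ≅-hubs : G ≅ induced corona (image hub)
  ≅-hubs = ≅-induced-image {G = G} {H = corona} hub (combine-injectiveˡ _ zero _ zero)
    λ a b → mk⇔ (adj⁺ a zero b zero) (adj⁻ a zero b zero)

corollary6 : ∀ {n : ℕ} (G : Graph (Fin n)) → Connected G →
    ∃₂ λ (m : ℕ) (H : Graph (Fin m)) →
    IsSRGraph H × ∃ λ S → G ≅ induced H S
corollary6 {n} G connected =
  n * 3 , corona , corona-isSRGraph connected , image hub , ≅-hubs
  where open TwoLeafCorona G
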